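{- The systems $\mathsf{MLSu}$, $\mathsf{MLSl}$, $\mathsf{MLSd}$, $\mathsf{MLSi}$, $\mathsf{MLSdl}$, $\mathsf{MLSli}$, $\mathsf{MLSdi}$ and $\mathsf{MLSdli}$ are equivalent, i.e. they all prove the same structures.
   Context: Structures. There are countably many atoms $a,b,c,\dots$; structures of multiplicative linear logic are generated by $R ::= a \mid \mathsf 1 \mid \bot \mid [R \wp R] \mid (R\otimes R) \mid \overline{R}$, where $\mathsf 1$ and $\bot$ (the units) are regarded as special atoms. $[R\wp T]$ is called a par structure, $(R\otimes T)$ a copar structure. Structures are considered modulo $\approx$, the smallest congruence induced by associativity and commutativity of $\wp$ and of $\otimes$ and by $\overline{[R\wp T]}\approx(\overline R\otimes\overline T)$, $\overline{(R\otimes T)}\approx[\overline R\wp\overline T]$, $\overline{\overline R}\approx R$, $\overline\bot\approx\mathsf 1$, $\overline{\mathsf 1}\approx\bot$; they are taken in negation normal form. A context $S\{\ \}$ is a structure with one hole not in the scope of a negation; $S\{R\}$ is the result of filling it with $R$; $S[R\wp T]$, $S(R\otimes T)$ abbreviate $S\{[R\wp T]\}$, $S\{(R\otimes T)\}$. $\mathsf{at}\,R$ is the set of atoms (including units; $a$ and $\overline a$ are different elements) occurring in $R$ in negation normal form. Rules (for all contexts $S\{\ \}$, structures $R,T,U$, atoms $a$): - $\mathsf{ai}{\downarrow}$: premise $S\{\mathsf 1\}$, conclusion $S[a\wp\overline a]$. - $\mathsf u_1{\downarrow}$: premise $S\{R\}$, conclusion $S[R\wp\bot]$. - $\mathsf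 u_2{\downarrow}$: premise $S\{R\}$, conclusion $S(R\otimes\mathsf 1)$. - $\mathsf s$ (switch): premise $S([U\wp R]\otimes T)$, conclusion $S[U\wp(R\otimes T)]$. An instance of switch (with the given $R,T,U$) satisfies the condition "interaction" if $\mathsf{at}\,\overline R\cap\mathsf{at}\,U\neq\emptyset$; "lazy" if $U$ is a copar structure or an atom different from $\bot$; "deep" if $R$ is a par structure or an atom different from $\mathsf 1$. The rules $\mathsf{ls},\mathsf{ds},\mathsf{is},\mathsf{dls},\mathsf{lis},\mathsf{dis},\mathsf{dlis}$ are the restrictions of $\mathsf s$ to instances satisfying, respectively: lazy; deep; interaction; deep and lazy; lazy and interaction; deep and interaction; all three. Systems: each consists of $\mathsf{ai}{\downarrow},\mathsf u_1{\downarrow},\mathsf u_2{\downarrow}$ together with one switch rule: $\mathsf{MLSu}$ has $\mathsf s$, $\mathsf{MLSl}$ has $\mathsf{ls}$, $\mathsf{MLSd}$ has $\mathsf{ds}$, $\mathsf{MLSi}$ has $\mathsf{is}$, $\mathsf{MLSdl}$ has $\mathsf{dls}$, $\mathsf{MLSli}$ has $\mathsf{lis}$, $\mathsf{MLSdi}$ has $\mathsf{dis}$, $\mathsf{MLSdli}$ has $\mathsf{dlis}$. A derivation in a system is a finite chain of instances of its rules (possibly none) leading from its top-most structure (premise) to its bottom-most structure (conclusion). A proof of $R$ is a derivation with premise $\mathsf 1$ and conclusion $R$. Two systems are equivalent if they prove the same structures. -}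

module Defs where

open import Level using (0ℓ)
open import Data.Nat.Base using (ℕ)
open import Data.List.Base using (List; [_]; _++_)
open import Data.List.Membership.Propositional using (_∈_)
open import Data.Product.Base using (_×_; ∃-syntax)
open import Data.Sum.Base using (_⊎_)
open import Function.Bundles using (_⇔_)
open import Relation.Binary.Core using (Rel)
open import Relation.Binary.Construct.Intersection using (_∩_)
open import Relation.Binary.Construct.Union using (_∪_)
open import Relation.Binary.PropositionalEquality.Core using (_≢_)

infixr 6 _⅋_ _⊗_
infix  4 _≈_

data Structure : Set where
  var     : ℕ → Structure
  one bot : Structure
  _⅋_ _⊗_ : Structure → Structure → Structure
  neg     : Structure → Structure

data _≈_ : Rel Structure 0ℓ where
  ≈-refl  : ∀ {R} → R ≈ R
  ≈-sym   : ∀ {R T} → R ≈ T → T ≈ R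
  ≈-trans : ∀ {R T U} → R ≈ T → T ≈ U → R ≈ U

  ⅋-cong   : ∀ {R R′ T T′} → R ≈ R′ → T ≈ T′ → R ⅋ T ≈ R′ ⅋ T′
  ⊗-cong   : ∀ {R R′ T T′} → R ≈ R′ → T ≈ T′ → R ⊗ T ≈ R′ ⊗ T′
  neg-cong : ∀ {R R′} → R ≈ R′ → neg R ≈ neg R′

  ⅋-assoc : ∀ {R T U} → (R ⅋ T) ⅋ U ≈ R ⅋ (T ⅋ U)
  ⅋-comm  : ∀ {R T} → R ⅋ T ≈ T ⅋ R
  ⊗-assoc : ∀ {R T U} → (R ⊗ T) ⊗ U ≈ R ⊗ (T ⊗ U)
  ⊗-comm  : ∀ {R T} → R ⊗ T ≈ T ⊗ R

  neg-⅋   : ∀ {R T} → neg (R ⅋ T) ≈ neg R ⊗ neg T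
  neg-⊗   : ∀ {R T} → neg (R ⊗ T) ≈ neg R ⅋ neg T
  neg-neg : ∀ {R} → neg (neg R) ≈ R
  neg-bot : neg bot ≈ one
  neg-one : neg one ≈ bot

-- The atoms of structures in negation normal form: a variable and its negation
-- are different atoms, and the units are special atoms.
data Atom : Set where
  pos neg : ℕ → Atom
  one bot : Atom

⌜_⌝ : Atom → Structure
⌜ pos n ⌝ = var n
⌜ neg n ⌝ = neg (var n)
⌜ one ⌝   = one
⌜ bot ⌝   = bot

data NNF : Set where
  atom    : Atom → NNF
  _⅋_ _⊗_ : NNF → NNF → NNF

dualAtom : Atom → Atom
dualAtom (pos n) = neg n
dualAtom (neg n) = pos n
dualAtom one     = bot
dualAtom bot     = one

dual : NNF → NNF
dual (atom a) = atom (dualAtom a)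
dual (R ⅋ T)  = dual R ⊗ dual T
dual (R ⊗ T)  = dual R ⅋ dual T

nnf : Structure → NNF
nnf (var n) = atom (pos n)
nnf one     = atom one
nnf bot     = atom bot
nnf (R ⅋ T) = nnf R ⅋ nnf T
nnf (R ⊗ T) = nnf R ⊗ nnf T
nnf (neg R) = dual (nnf R)

atoms : NNF → List Atom
atoms (atom a) = [ a ]
atoms (R ⅋ T)  = atoms R ++ atoms T
atoms (R ⊗ T)  = atoms R ++ atoms T

-- A list representing the set at R; only membership in it is ever used.
at : Structure → List Atom
at R = atoms (nnf R)

-- Structures are classes modulo ≈, so being a par structure, a copar structure
-- or an atom is a property of the class.
IsPar : Structure → Set
IsPar R = ∃[ T ] ∃[ U ] R ≈ T ⅋ U

IsCopar : Structure → Set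
IsCopar R = ∃[ T ] ∃[ U ] R ≈ T ⊗ U

IsAtomOtherThan : Atom → Structure → Set
IsAtomOtherThan b R = ∃[ a ] a ≢ b × R ≈ ⌜ a ⌝

-- There is no constructor for negation: the hole is never in its scope.
data Context : Set where
  ∙         : Context
  _⅋ˡ_ _⊗ˡ_ : Context → Structure → Context
  _⅋ʳ_ _⊗ʳ_ : Structure → Context → Context

_⟨_⟩ : Context → Structure → Structure
∙        ⟨ R ⟩ = R
(S ⅋ˡ T) ⟨ R ⟩ = S ⟨ R ⟩ ⅋ T
(S ⊗ˡ T) ⟨ R ⟩ = S ⟨ R ⟩ ⊗ T
(T ⅋ʳ S) ⟨ R ⟩ = T ⅋ S ⟨ R ⟩
(T ⊗ʳ S) ⟨ R ⟩ = T ⊗ S ⟨ R ⟩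

-- A rule relates what fills the hole in the premise to what fills it in the
-- conclusion; `Instance` below closes it under contexts.
Rule : Set₁
Rule = Rel Structure 0ℓ

data ai↓ : Rule where
  ai : ∀ a → ai↓ one (⌜ a ⌝ ⅋ neg ⌜ a ⌝)

data u₁↓ : Rule where
  u₁ : ∀ R → u₁↓ R (R ⅋ bot)

data u₂↓ : Rule where
  u₂ : ∀ R → u₂↓ R (R ⊗ one)

data s : Rule where
  switch : ∀ R T U → s ((U ⅋ R) ⊗ T) (U ⅋ (R ⊗ T))

-- A condition on the pair R , U of a switch instance.
Condition : Set₁
Condition = Rel Structure 0ℓ

Interaction Lazy Deep : Condition
Interaction R U = ∃[ a ] a ∈ at (neg R) × a ∈ at U
Lazy        R U = IsCopar U ⊎ IsAtomOtherThan bot U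
Deep        R U = IsPar R ⊎ IsAtomOtherThan one R

data s-if (C : Condition) : Rule where
  switch : ∀ R T U → C R U → s-if C ((U ⅋ R) ⊗ T) (U ⅋ (R ⊗ T))

ls ds is dls lis dis dlis : Rule
ls   = s-if Lazy
ds   = s-if Deep
is   = s-if Interaction
dls  = s-if (Deep ∩ Lazy)
lis  = s-if (Lazy ∩ Interaction)
dis  = s-if (Deep ∩ Interaction)
dlis = s-if (Deep ∩ (Lazy ∩ Interaction))

data System : Set where
  MLSu MLSl MLSd MLSi MLSdl MLSli MLSdi MLSdli : System

switchRule : System → Rule
switchRule MLSu   = s
switchRule MLSl   = ls
switchRule MLSd   = ds
switchRule MLSi   = is
switchRule MLSdl  = dls
switchRule MLSli  = lis
switchRule MLSdi  = dis
switchRule MLSdli = dlis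

rules : System → Rule
rules 𝒮 = ai↓ ∪ (u₁↓ ∪ (u₂↓ ∪ switchRule 𝒮))

Instance : System → Rel Structure 0ℓ
Instance 𝒮 P Q =
  ∃[ S ] ∃[ R ] ∃[ T ] rules 𝒮 R T × P ≈ S ⟨ R ⟩ × Q ≈ S ⟨ T ⟩

-- The first index is the premise, the second the conclusion. The empty
-- derivation uses ≈ because structures are classes modulo ≈.
data Derivation (𝒮 : System) : Rel Structure 0ℓ where
  []  : ∀ {P Q} → P ≈ Q → Derivation 𝒮 P Q
  _∷_ : ∀ {P Q R} → Instance 𝒮 P Q → Derivation 𝒮 Q R → Derivation 𝒮 P R

Proof : System → Structure → Set
Proof 𝒮 R = Derivation 𝒮 one R

Equivalent : System → System → Set
Equivalent 𝒮 𝒯 = ∀ R → Proof 𝒮 R ⇔ Proof 𝒯 R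

{-# OPTIONS --safe #-}

-- Every system is sound for the cut-free one-sided sequent calculus of
-- multiplicative linear logic, because a premise can be replaced by its
-- conclusion at the point where it is introduced in a sequent proof. Conversely,
-- a provable structure other than 1 has a provable premise in MLSdli, found by
-- induction on the sequent proof: below A ⊗ B, a step for the premise ⊢ A, Γ either
-- stays inside A, or stays inside Γ, or involves both. In the last case A interacts
-- with some member of Γ, and a single switch moves that member into A or, if A is
-- itself a copar, possibly A ⊗ B into that member. Each rule instance, read from
-- its conclusion to its premise, lowers the number of atoms plus the number of pairs
-- of atoms in the par relation, so the search ends in 1.
module Submission where

open import Defs
open import Data.List.Base using (List; []; _∷_; [_]; _++_; foldr; replicate)
open import Data.List.Membership.Propositional using (_∈_)
open import Data.List.Membership.Propositional.Properties
  using (∈-∃++; ∈-++⁺ˡ; ∈-++⁺ʳ; ∈-++⁻)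
open import Data.List.Relation.Unary.All using (All; []; _∷_)
import Data.List.Relation.Unary.All.Properties as All
open import Data.List.Relation.Unary.Any using (here; there)
open import Data.List.Relation.Binary.Permutation.Propositional
  using (_↭_; refl; prep; swap; trans; ↭-sym; ↭-reflexive)
open import Data.List.Relation.Binary.Permutation.Propositional.Properties
  using (∈-resp-↭; All-resp-↭; drop-∷; shift; shifts; ++⁺ˡ; ++⁺ʳ; ++-comm; ++-assoc;
         ++-identityʳ; ++-commutativeMonoid; ¬x∷xs↭[]; ↭-singleton-inv)
open import Algebra.Solver.CommutativeMonoid (++-commutativeMonoid {A = NNF})
  using (solve; _⊕_; _⊜_) renaming (id to ε)
open import Data.Nat.Base using (ℕ; zero; suc; _+_; _*_; _≤_; _<_; s≤s; z≤n)
open import Data.Nat.Induction using (<-wellFounded)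
open import Data.Nat.Properties
  using (≤-refl; ≤-reflexive; ≤-trans; +-monoˡ-≤; +-mono-<-≤; *-mono-≤; *-monoˡ-≤;
         m≤m+n; m<m+n; +-comm; *-comm; +-assoc)
open import Data.Nat.Tactic.RingSolver using (solve-∀)
open import Data.Product.Base using (_×_; _,_; proj₁; ∃-syntax)
open import Data.Sum.Base using (_⊎_; inj₁; inj₂)
open import Function.Base using (id; _∘_)
open import Function.Bundles using (mk⇔)
open import Induction.WellFounded using (Acc; acc)
open import Relation.Nullary.Negation using (¬_; contradiction)
open import Relation.Binary.PropositionalEquality
  using (_≡_; _≢_; refl; sym; cong; cong₂; subst; subst₂)
  renaming (trans to ≡-trans)

private variable
  A A′ B B′ C F F′ G U V : NNF
  Γ Δ Θ K L M N : List NNF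

-- Locating an element in a permuted list.

∷-↭-∷ : A ∷ Γ ↭ B ∷ Δ →
        (A ≡ B × Γ ↭ Δ) ⊎ ∃[ Θ ] Γ ↭ B ∷ Θ × Δ ↭ A ∷ Θ
∷-↭-∷ {A} {Γ} {B} p with ∈-resp-↭ (↭-sym p) (here refl)
... | here refl = inj₁ (refl , drop-∷ p)
... | there B∈Γ with Γ₁ , Γ₂ , refl ← ∈-∃++ B∈Γ =
  inj₂ (Γ₁ ++ Γ₂ , shift B Γ₁ Γ₂ ,
        drop-∷ (trans (↭-sym p) (trans (prep A (shift B Γ₁ Γ₂)) (swap A B refl))))

++-↭-∷ : ∀ Γ → Γ ++ Δ ↭ A ∷ Θ →
         (∃[ Γ′ ] Γ ↭ A ∷ Γ′ × Θ ↭ Γ′ ++ Δ) ⊎ (∃[ Δ′ ] Δ ↭ A ∷ Δ′ × Θ ↭ Γ ++ Δ′)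
++-↭-∷ [] p = inj₂ (_ , p , refl)
++-↭-∷ (B ∷ Γ) p with ∷-↭-∷ p
... | inj₁ (refl , q) = inj₁ (Γ , refl , ↭-sym q)
... | inj₂ (Ξ , q , r) with ++-↭-∷ Γ q
... | inj₁ (Γ′ , s , t) =
  inj₁ (B ∷ Γ′ , trans (prep B s) (swap B _ refl) , trans r (prep B t))
... | inj₂ (Δ′ , s , t) = inj₂ (Δ′ , s , trans r (prep B t))

-- The one-sided sequent calculus and its inversion.

flat : NNF → List NNF
flat (atom a) = [ atom a ]
flat (A ⅋ B)  = flat A ++ flat B
flat (A ⊗ B)  = [ A ⊗ B ]

infix 3 ⊢_

-- There is no rule for ⅋: sequents list the non-par components of structures.
data ⊢_ : List NNF → Set where
  one  : ⊢ [ atom one ]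
  ax   : ∀ n → ⊢ atom (pos n) ∷ [ atom (neg n) ]
  bot  : ⊢ Γ → ⊢ atom bot ∷ Γ
  ten  : ⊢ flat A ++ Γ → ⊢ flat B ++ Δ → ⊢ A ⊗ B ∷ Γ ++ Δ
  perm : Γ ↭ Δ → ⊢ Γ → ⊢ Δ

-- The ways in which a last rule other than exchange can have the given structure as principal,
-- together with the remaining context.
data Intro : NNF → List NNF → Set where
  one : Intro (atom one) []
  bot : ⊢ Γ → Intro (atom bot) Γ
  pos : ∀ n → Intro (atom (pos n)) [ atom (neg n) ]
  neg : ∀ n → Intro (atom (neg n)) [ atom (pos n) ]
  ten : ⊢ flat A ++ Γ → ⊢ flat B ++ Δ → Intro (A ⊗ B) (Γ ++ Δ)

module _ {X : NNF} {Θ : List NNF} (intro : ∀ {Γ} → Intro X Γ → ⊢ Θ ++ Γ) where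

  private
    -- Follows `X` up to the rule that introduces it, puts `Θ` there and replays the rules passed on
    -- the way. As `L` is given only up to permutation, exchange is absorbed into the second
    -- argument.
    go : ⊢ L → L ↭ X ∷ Γ → ⊢ Θ ++ Γ
    go one p with ∷-↭-∷ p
    ... | inj₁ (refl , q) = perm (++⁺ˡ Θ q) (intro one)
    ... | inj₂ (_ , q , _) with () ← ¬x∷xs↭[] (↭-sym q)
    go (ax n) p with ∷-↭-∷ p
    ... | inj₁ (refl , q) = perm (++⁺ˡ Θ q) (intro (pos n))
    ... | inj₂ (_ , q , r) with ∷-↭-∷ q
    ... | inj₁ (refl , s) = perm (++⁺ˡ Θ (trans (prep _ s) (↭-sym r))) (intro (neg n))
    ... | inj₂ (_ , s , _) with () ← ¬x∷xs↭[] (↭-sym s)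
    go (bot d) p with ∷-↭-∷ p
    ... | inj₁ (refl , q) = perm (++⁺ˡ Θ q) (intro (bot d))
    ... | inj₂ (Ξ , q , r) =
      perm (trans (↭-sym (shift _ Θ Ξ)) (++⁺ˡ Θ (↭-sym r))) (bot (go d q))
    go (perm q d) p = go d (trans q p)
    go (ten {A} {Γ} {B} {Δ} d e) p with ∷-↭-∷ p
    ... | inj₁ (refl , q) = perm (++⁺ˡ Θ q) (intro (ten d e))
    ... | inj₂ (Ξ , q , r) with ++-↭-∷ Γ q
    ... | inj₁ (Γ′ , s , t) =
      perm (trans (solve 4 (λ x a b c → x ⊕ ((a ⊕ b) ⊕ c) ⊜ a ⊕ (x ⊕ (b ⊕ c)))
                     refl [ A ⊗ B ] Θ Γ′ Δ)
             (++⁺ˡ Θ (trans (prep _ (↭-sym t)) (↭-sym r))))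
        (ten (perm (shifts Θ (flat A))
               (go d (trans (++⁺ˡ (flat A) s) (shift X (flat A) Γ′)))) e)
    ... | inj₂ (Δ′ , s , t) =
      perm (trans (solve 4 (λ x a b c → x ⊕ (b ⊕ (a ⊕ c)) ⊜ a ⊕ (x ⊕ (b ⊕ c)))
                     refl [ A ⊗ B ] Θ Γ Δ′)
             (++⁺ˡ Θ (trans (prep _ (↭-sym t)) (↭-sym r))))
        (ten d (perm (shifts Θ (flat B))
                 (go e (trans (++⁺ˡ (flat B) s) (shift X (flat B) Δ′)))))

  replace : ⊢ X ∷ Γ → ⊢ Θ ++ Γ
  replace d = go d refl

⊗-elim : ∀ Θ → (∀ {Γ Δ} → ⊢ flat A ++ Γ → ⊢ flat B ++ Δ → ⊢ Θ ++ Γ ++ Δ) →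
         ⊢ A ⊗ B ∷ Γ → ⊢ Θ ++ Γ
⊗-elim Θ f = replace λ where (ten d e) → f d e

-- Soundness of all systems for the sequent calculus.

infix 4 _≋_ _⊑_

data _≋_ : NNF → NNF → Set where
  ≋-refl  : A ≋ A
  ≋-sym   : A ≋ B → B ≋ A
  ≋-trans : A ≋ B → B ≋ C → A ≋ C
  ⅋-cong  : A ≋ A′ → B ≋ B′ → A ⅋ B ≋ A′ ⅋ B′
  ⊗-cong  : A ≋ A′ → B ≋ B′ → A ⊗ B ≋ A′ ⊗ B′
  ⅋-assoc : (A ⅋ B) ⅋ C ≋ A ⅋ (B ⅋ C)
  ⅋-comm  : A ⅋ B ≋ B ⅋ A
  ⊗-assoc : (A ⊗ B) ⊗ C ≋ A ⊗ (B ⊗ C)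
  ⊗-comm  : A ⊗ B ≋ B ⊗ A

dualAtom-involutive : ∀ a → dualAtom (dualAtom a) ≡ a
dualAtom-involutive (pos n) = refl
dualAtom-involutive (neg n) = refl
dualAtom-involutive one     = refl
dualAtom-involutive bot     = refl

dual-involutive : ∀ A → dual (dual A) ≡ A
dual-involutive (atom a) = cong atom (dualAtom-involutive a)
dual-involutive (A ⅋ B)  = cong₂ _⅋_ (dual-involutive A) (dual-involutive B)
dual-involutive (A ⊗ B)  = cong₂ _⊗_ (dual-involutive A) (dual-involutive B)

dual-cong : A ≋ B → dual A ≋ dual B
dual-cong ≋-refl        = ≋-refl
dual-cong (≋-sym p)     = ≋-sym (dual-cong p)
dual-cong (≋-trans p q) = ≋-trans (dual-cong p) (dual-cong q)
dual-cong (⅋-cong p q)  = ⊗-cong (dual-cong p) (dual-cong q)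
dual-cong (⊗-cong p q)  = ⅋-cong (dual-cong p) (dual-cong q)
dual-cong ⅋-assoc       = ⊗-assoc
dual-cong ⅋-comm        = ⊗-comm
dual-cong ⊗-assoc       = ⅋-assoc
dual-cong ⊗-comm        = ⅋-comm

nnf-cong : ∀ {R T} → R ≈ T → nnf R ≋ nnf T
nnf-cong ≈-refl           = ≋-refl
nnf-cong (≈-sym p)        = ≋-sym (nnf-cong p)
nnf-cong (≈-trans p q)    = ≋-trans (nnf-cong p) (nnf-cong q)
nnf-cong (⅋-cong p q)     = ⅋-cong (nnf-cong p) (nnf-cong q)
nnf-cong (⊗-cong p q)     = ⊗-cong (nnf-cong p) (nnf-cong q)
nnf-cong (neg-cong p)     = dual-cong (nnf-cong p)
nnf-cong ⅋-assoc          = ⅋-assoc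
nnf-cong ⅋-comm           = ⅋-comm
nnf-cong ⊗-assoc          = ⊗-assoc
nnf-cong ⊗-comm           = ⊗-comm
nnf-cong neg-⅋            = ≋-refl
nnf-cong neg-⊗            = ≋-refl
nnf-cong (neg-neg {R}) rewrite dual-involutive (nnf R) = ≋-refl
nnf-cong neg-bot          = ≋-refl
nnf-cong neg-one          = ≋-refl

-- Quantifying over the side context `Γ` makes the relation compatible with both connectives, hence
-- with filling a context.
_⊑_ : NNF → NNF → Set
A ⊑ B = ∀ {Γ} → ⊢ flat A ++ Γ → ⊢ flat B ++ Γ

⅋-mono-⊑ : A ⊑ A′ → B ⊑ B′ → A ⅋ B ⊑ A′ ⅋ B′
⅋-mono-⊑ {A} {A′} {B} {B′} f g {Γ} d =
  perm (solve 3 (λ a b c → b ⊕ (a ⊕ c) ⊜ (a ⊕ b) ⊕ c) refl (flat A′) (flat B′) Γ)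
    (g (perm (shifts (flat A′) (flat B))
         (f (perm (++-assoc (flat A) (flat B) Γ) d))))

⊗-mono-⊑ : A ⊑ A′ → B ⊑ B′ → A ⊗ B ⊑ A′ ⊗ B′
⊗-mono-⊑ f g = ⊗-elim [ _ ] λ d e → ten (f d) (g e)

⅋-comm-⊑ : A ⅋ B ⊑ B ⅋ A
⅋-comm-⊑ {A} {B} = perm (++⁺ʳ _ (++-comm (flat A) (flat B)))

⊗-comm-⊑ : A ⊗ B ⊑ B ⊗ A
⊗-comm-⊑ = ⊗-elim [ _ ] λ {Γ} {Δ} d e → perm (prep _ (++-comm Δ Γ)) (ten e d)

⊗-assoc-⊑ : (A ⊗ B) ⊗ C ⊑ A ⊗ (B ⊗ C)
⊗-assoc-⊑ {A} {B} {C} = ⊗-elim [ _ ] λ {Γ} {Δ} d e →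
  perm (prep _ (++-comm Δ Γ))
    (⊗-elim (A ⊗ (B ⊗ C) ∷ Δ)
      (λ {Γ₁} {Γ₂} f g →
        perm (solve 4 (λ x a b c → x ⊕ (a ⊕ (b ⊕ c)) ⊜ (x ⊕ c) ⊕ (a ⊕ b)) refl
               [ A ⊗ (B ⊗ C) ] Γ₁ Γ₂ Δ)
          (ten f (ten g e)))
      d)

⊗-assoc-⊒ : A ⊗ (B ⊗ C) ⊑ (A ⊗ B) ⊗ C
⊗-assoc-⊒ {A} {B} {C} =
  ⊗-comm-⊑ {C} {A ⊗ B} ∘ ⊗-mono-⊑ {C} {C} {B ⊗ A} {A ⊗ B} id (⊗-comm-⊑ {B} {A}) ∘
  ⊗-assoc-⊑ {C} {B} {A} ∘
  ⊗-mono-⊑ {B ⊗ C} {C ⊗ B} {A} {A} (⊗-comm-⊑ {B} {C}) id ∘ ⊗-comm-⊑ {A} {B ⊗ C}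

≋⇒⊑⊒ : A ≋ B → A ⊑ B × B ⊑ A
≋⇒⊑⊒ ≋-refl = id , id
≋⇒⊑⊒ (≋-sym p) with f , g ← ≋⇒⊑⊒ p = g , f
≋⇒⊑⊒ (≋-trans p q) with f , f′ ← ≋⇒⊑⊒ p | g , g′ ← ≋⇒⊑⊒ q = g ∘ f , f′ ∘ g′
≋⇒⊑⊒ (⅋-cong {A} {A′} {B} {B′} p q) with f , f′ ← ≋⇒⊑⊒ p | g , g′ ← ≋⇒⊑⊒ q =
  ⅋-mono-⊑ {A} {A′} {B} {B′} f g , ⅋-mono-⊑ {A′} {A} {B′} {B} f′ g′
≋⇒⊑⊒ (⊗-cong {A} {A′} {B} {B′} p q) with f , f′ ← ≋⇒⊑⊒ p | g , g′ ← ≋⇒⊑⊒ q =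
  ⊗-mono-⊑ {A} {A′} {B} {B′} f g , ⊗-mono-⊑ {A′} {A} {B′} {B} f′ g′
≋⇒⊑⊒ (⅋-assoc {A} {B} {C}) =
  perm (++⁺ʳ _ (++-assoc (flat A) (flat B) (flat C))) ,
  perm (++⁺ʳ _ (↭-sym (++-assoc (flat A) (flat B) (flat C))))
≋⇒⊑⊒ (⅋-comm {A} {B}) = ⅋-comm-⊑ {A} {B} , ⅋-comm-⊑ {B} {A}
≋⇒⊑⊒ (⊗-assoc {A} {B} {C}) = ⊗-assoc-⊑ {A} {B} {C} , ⊗-assoc-⊒ {A} {B} {C}
≋⇒⊑⊒ (⊗-comm {A} {B}) = ⊗-comm-⊑ {A} {B} , ⊗-comm-⊑ {B} {A}

context-⊑ : ∀ S {R T} → nnf R ⊑ nnf T → nnf (S ⟨ R ⟩) ⊑ nnf (S ⟨ T ⟩)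
context-⊑ ∙ f = f
context-⊑ (S ⅋ˡ U) {R} {T} f =
  ⅋-mono-⊑ {nnf (S ⟨ R ⟩)} {nnf (S ⟨ T ⟩)} {nnf U} {nnf U} (context-⊑ S {R} {T} f) id
context-⊑ (S ⊗ˡ U) {R} {T} f =
  ⊗-mono-⊑ {nnf (S ⟨ R ⟩)} {nnf (S ⟨ T ⟩)} {nnf U} {nnf U} (context-⊑ S {R} {T} f) id
context-⊑ (U ⅋ʳ S) {R} {T} f =
  ⅋-mono-⊑ {nnf U} {nnf U} {nnf (S ⟨ R ⟩)} {nnf (S ⟨ T ⟩)} id (context-⊑ S {R} {T} f)
context-⊑ (U ⊗ʳ S) {R} {T} f =
  ⊗-mono-⊑ {nnf U} {nnf U} {nnf (S ⟨ R ⟩)} {nnf (S ⟨ T ⟩)} id (context-⊑ S {R} {T} f)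

ax-⊑ : ∀ a → atom one ⊑ nnf (⌜ a ⌝ ⅋ neg ⌜ a ⌝)
ax-⊑ a = replace λ where one → identity a
  where
  identity : ∀ a → ⊢ flat (nnf (⌜ a ⌝ ⅋ neg ⌜ a ⌝)) ++ []
  identity (pos n) = ax n
  identity (neg n) = perm (swap _ _ refl) (ax n)
  identity one     = perm (swap _ _ refl) (bot one)
  identity bot     = bot one

-- At the tensor rule for the premise, the components of `U` can be counted as side context of `R`,
-- so the same two subproofs give `R ⊗ T` next to `U`.
switch-⊑ : ∀ U R T → (U ⅋ R) ⊗ T ⊑ U ⅋ (R ⊗ T)
switch-⊑ U R T = ⊗-elim (flat U ++ [ R ⊗ T ]) λ {Γ} {Δ} d e →
  perm (solve 4 (λ u x a b → x ⊕ ((u ⊕ a) ⊕ b) ⊜ (u ⊕ x) ⊕ (a ⊕ b)) refl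
         (flat U) [ R ⊗ T ] Γ Δ)
    (ten (perm (solve 3 (λ u r a → (u ⊕ r) ⊕ a ⊜ r ⊕ (u ⊕ a)) refl
                 (flat U) (flat R) Γ) d) e)

s-if⇒s : ∀ {C R T} → s-if C R T → s R T
s-if⇒s (switch R T U _) = switch R T U

switchRule⇒s : ∀ 𝒮 {R T} → switchRule 𝒮 R T → s R T
switchRule⇒s MLSu   = id
switchRule⇒s MLSl   = s-if⇒s
switchRule⇒s MLSd   = s-if⇒s
switchRule⇒s MLSi   = s-if⇒s
switchRule⇒s MLSdl  = s-if⇒s
switchRule⇒s MLSli  = s-if⇒s
switchRule⇒s MLSdi  = s-if⇒s
switchRule⇒s MLSdli = s-if⇒s

rule-⊑ : ∀ 𝒮 {R T} → rules 𝒮 R T → nnf R ⊑ nnf T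
rule-⊑ 𝒮 (inj₁ (ai a)) = ax-⊑ a
rule-⊑ 𝒮 (inj₂ (inj₁ (u₁ R))) {Γ} d =
  perm (solve 3 (λ b r c → b ⊕ (r ⊕ c) ⊜ (r ⊕ b) ⊕ c) refl
         [ atom bot ] (flat (nnf R)) Γ)
    (bot d)
rule-⊑ 𝒮 (inj₂ (inj₂ (inj₁ (u₂ R)))) {Γ} d =
  perm (solve 2 (λ x c → x ⊕ (c ⊕ ε) ⊜ x ⊕ c) refl [ nnf R ⊗ atom one ] Γ) (ten d one)
rule-⊑ 𝒮 (inj₂ (inj₂ (inj₂ r))) with switch R T U ← switchRule⇒s 𝒮 r =
  switch-⊑ (nnf U) (nnf R) (nnf T)

infix 3 ⊩_

⊩_ : NNF → Set
⊩ A = ⊢ flat A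

⊑-⊩ : A ⊑ B → ⊩ A → ⊩ B
⊑-⊩ {A} {B} f d =
  perm (++-identityʳ (flat B)) (f (perm (↭-sym (++-identityʳ (flat A))) d))

≋-⊩ : A ≋ B → ⊩ A → ⊩ B
≋-⊩ {A} {B} p = ⊑-⊩ {A} {B} (proj₁ (≋⇒⊑⊒ p))

derivation-⊩ : ∀ 𝒮 {P Q} → Derivation 𝒮 P Q → ⊩ nnf P → ⊩ nnf Q
derivation-⊩ 𝒮 ([] p) d = ≋-⊩ (nnf-cong p) d
derivation-⊩ 𝒮 ((S , R , T , r , p , q) ∷ Ds) d =
  derivation-⊩ 𝒮 Ds
    (≋-⊩ (nnf-cong (≈-sym q))
      (⊑-⊩ {nnf (S ⟨ R ⟩)} {nnf (S ⟨ T ⟩)} (context-⊑ S {R} {T} (rule-⊑ 𝒮 {R} {T} r))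
        (≋-⊩ (nnf-cong p) d)))

-- The termination measure.

size : NNF → ℕ
size (atom a) = 1
size (A ⅋ B)  = size A + size B
size (A ⊗ B)  = size A + size B

-- The number of atoms plus the number of pairs of atoms that meet at a ⅋.
weight : NNF → ℕ
weight (atom a) = 1
weight (A ⅋ B)  = weight A + weight B + size A * size B
weight (A ⊗ B)  = weight A + weight B

size-cong : A ≋ B → size A ≡ size B
size-cong ≋-refl        = refl
size-cong (≋-sym p)     = sym (size-cong p)
size-cong (≋-trans p q) = ≡-trans (size-cong p) (size-cong q)
size-cong (⅋-cong p q)  = cong₂ _+_ (size-cong p) (size-cong q)
size-cong (⊗-cong p q)  = cong₂ _+_ (size-cong p) (size-cong q)
size-cong (⅋-assoc {A} {B} {C}) = +-assoc (size A) (size B) (size C)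
size-cong (⅋-comm {A} {B}) = +-comm (size A) (size B)
size-cong (⊗-assoc {A} {B} {C}) = +-assoc (size A) (size B) (size C)
size-cong (⊗-comm {A} {B}) = +-comm (size A) (size B)

weight-cong : A ≋ B → weight A ≡ weight B
weight-cong ≋-refl        = refl
weight-cong (≋-sym p)     = sym (weight-cong p)
weight-cong (≋-trans p q) = ≡-trans (weight-cong p) (weight-cong q)
weight-cong (⅋-cong p q)  = cong₂ _+_ (cong₂ _+_ (weight-cong p) (weight-cong q))
                                      (cong₂ _*_ (size-cong p) (size-cong q))
weight-cong (⊗-cong p q)  = cong₂ _+_ (weight-cong p) (weight-cong q)
weight-cong (⅋-assoc {A} {B} {C}) =
  assoc (size A) (size B) (size C) (weight A) (weight B) (weight C)
  where
  assoc : ∀ a b c x y z →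
          x + y + a * b + z + (a + b) * c ≡ x + (y + z + b * c) + a * (b + c)
  assoc = solve-∀
weight-cong (⅋-comm {A} {B}) =
  cong₂ _+_ (+-comm (weight A) (weight B)) (*-comm (size A) (size B))
weight-cong (⊗-assoc {A} {B} {C}) = +-assoc (weight A) (weight B) (weight C)
weight-cong (⊗-comm {A} {B}) = +-comm (weight A) (weight B)

size>0 : ∀ A → 0 < size A
size>0 (atom a) = s≤s z≤n
size>0 (A ⅋ B)  = ≤-trans (size>0 A) (m≤m+n _ _)
size>0 (A ⊗ B)  = ≤-trans (size>0 A) (m≤m+n _ _)

infix 4 _≺_

-- The weight of a par involves the sizes of its two sides, so a decrease in weight passes through a
-- par context only if the size does not grow.
record _≺_ (A B : NNF) : Set where
  constructor _,_
  field
    size-≤   : size A ≤ size B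
    weight-< : weight A < weight B

≺-resp-≋ : A ≋ A′ → B ≋ B′ → A ≺ B → A′ ≺ B′
≺-resp-≋ p q (s≤ , w<) =
  subst₂ _≤_ (size-cong p) (size-cong q) s≤ ,
  subst₂ _<_ (weight-cong p) (weight-cong q) w<

⅋-monoˡ-≺ : A ≺ B → A ⅋ C ≺ B ⅋ C
⅋-monoˡ-≺ {C = C} (s≤ , w<) =
  +-monoˡ-≤ _ s≤ , +-mono-<-≤ (+-mono-<-≤ w< ≤-refl) (*-monoˡ-≤ (size C) s≤)

⊗-monoˡ-≺ : A ≺ B → A ⊗ C ≺ B ⊗ C
⊗-monoˡ-≺ (s≤ , w<) = +-monoˡ-≤ _ s≤ , +-mono-<-≤ w< ≤-refl

context-≺ : ∀ S {R T} → nnf R ≺ nnf T → nnf (S ⟨ R ⟩) ≺ nnf (S ⟨ T ⟩)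
context-≺ ∙        p = p
context-≺ (S ⅋ˡ U) p = ⅋-monoˡ-≺ (context-≺ S p)
context-≺ (S ⊗ˡ U) p = ⊗-monoˡ-≺ (context-≺ S p)
context-≺ (U ⅋ʳ S) p = ≺-resp-≋ ⅋-comm ⅋-comm (⅋-monoˡ-≺ {C = nnf U} (context-≺ S p))
context-≺ (U ⊗ʳ S) p = ≺-resp-≋ ⊗-comm ⊗-comm (⊗-monoˡ-≺ {C = nnf U} (context-≺ S p))

-- The size is unchanged, and the premise lacks exactly the `size U * size T` pairs between `U` and
-- `T`.
switch-≺ : ∀ U R T → (U ⅋ R) ⊗ T ≺ U ⅋ (R ⊗ T)
switch-≺ U R T =
  ≤-reflexive (+-assoc (size U) (size R) (size T)) ,
  subst (weight ((U ⅋ R) ⊗ T) <_)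
    (expand (size U) (size R) (size T) (weight U) (weight R) (weight T))
    (m<m+n _ (*-mono-≤ (size>0 U) (size>0 T)))
  where
  expand : ∀ u r t x y z → x + y + u * r + z + u * t ≡ x + (y + z) + u * (r + t)
  expand = solve-∀

rule-≺ : ∀ 𝒮 {R T} → rules 𝒮 R T → nnf R ≺ nnf T
rule-≺ 𝒮 (inj₁ (ai (pos n))) = s≤s z≤n , s≤s (s≤s z≤n)
rule-≺ 𝒮 (inj₁ (ai (neg n))) = s≤s z≤n , s≤s (s≤s z≤n)
rule-≺ 𝒮 (inj₁ (ai one))     = s≤s z≤n , s≤s (s≤s z≤n)
rule-≺ 𝒮 (inj₁ (ai bot))     = s≤s z≤n , s≤s (s≤s z≤n)
rule-≺ 𝒮 (inj₂ (inj₁ (u₁ R))) =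
  m≤m+n _ _ , ≤-trans (m<m+n (weight (nnf R)) (s≤s z≤n)) (m≤m+n _ _)
rule-≺ 𝒮 (inj₂ (inj₂ (inj₁ (u₂ R)))) = m≤m+n _ _ , m<m+n (weight (nnf R)) (s≤s z≤n)
rule-≺ 𝒮 (inj₂ (inj₂ (inj₂ r))) with switch R T U ← switchRule⇒s 𝒮 r =
  switch-≺ (nnf U) (nnf R) (nnf T)

instance-≺ : ∀ 𝒮 {P Q} → Instance 𝒮 P Q → nnf P ≺ nnf Q
instance-≺ 𝒮 (S , R , T , r , p , q) =
  ≺-resp-≋ (nnf-cong (≈-sym p)) (nnf-cong (≈-sym q)) (context-≺ S (rule-≺ 𝒮 r))

-- Rule instances of `MLSdli` between negation normal forms.

emb : NNF → Structure
emb (atom a) = ⌜ a ⌝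
emb (A ⅋ B)  = emb A ⅋ emb B
emb (A ⊗ B)  = emb A ⊗ emb B

emb-cong : A ≋ B → emb A ≈ emb B
emb-cong ≋-refl        = ≈-refl
emb-cong (≋-sym p)     = ≈-sym (emb-cong p)
emb-cong (≋-trans p q) = ≈-trans (emb-cong p) (emb-cong q)
emb-cong (⅋-cong p q)  = ⅋-cong (emb-cong p) (emb-cong q)
emb-cong (⊗-cong p q)  = ⊗-cong (emb-cong p) (emb-cong q)
emb-cong ⅋-assoc       = ⅋-assoc
emb-cong ⅋-comm        = ⅋-comm
emb-cong ⊗-assoc       = ⊗-assoc
emb-cong ⊗-comm        = ⊗-comm

nnf-emb : ∀ A → nnf (emb A) ≡ A
nnf-emb (atom (pos n)) = refl
nnf-emb (atom (neg n)) = refl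
nnf-emb (atom one)     = refl
nnf-emb (atom bot)     = refl
nnf-emb (A ⅋ B)        = cong₂ _⅋_ (nnf-emb A) (nnf-emb B)
nnf-emb (A ⊗ B)        = cong₂ _⊗_ (nnf-emb A) (nnf-emb B)

emb-dual : ∀ A → emb (dual A) ≈ neg (emb A)
emb-dual (atom (pos n)) = ≈-refl
emb-dual (atom (neg n)) = ≈-sym neg-neg
emb-dual (atom one)     = ≈-sym neg-one
emb-dual (atom bot)     = ≈-sym neg-bot
emb-dual (A ⅋ B)        = ≈-trans (⊗-cong (emb-dual A) (emb-dual B)) (≈-sym neg-⅋)
emb-dual (A ⊗ B)        = ≈-trans (⅋-cong (emb-dual A) (emb-dual B)) (≈-sym neg-⊗)

emb-nnf : ∀ R → emb (nnf R) ≈ R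
emb-nnf (var n) = ≈-refl
emb-nnf one     = ≈-refl
emb-nnf bot     = ≈-refl
emb-nnf (R ⅋ T) = ⅋-cong (emb-nnf R) (emb-nnf T)
emb-nnf (R ⊗ T) = ⊗-cong (emb-nnf R) (emb-nnf T)
emb-nnf (neg R) = ≈-trans (emb-dual (nnf R)) (neg-cong (emb-nnf R))

infix 4 _⇝_

-- A record, so that `A` and `B` can be inferred from the type; they could not be recovered from
-- their images under `emb`.
record _⇝_ (A B : NNF) : Set where
  constructor ⟪_⟫
  field
    inst : Instance MLSdli (emb A) (emb B)

⇝-resp-≋ : A ≋ A′ → B ≋ B′ → A ⇝ B → A′ ⇝ B′
⇝-resp-≋ p q ⟪ S , R , T , r , a , b ⟫ =
  ⟪ S , R , T , r , ≈-trans (emb-cong (≋-sym p)) a , ≈-trans (emb-cong (≋-sym q)) b ⟫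

⅋-⇝ʳ : A ⇝ B → C ⅋ A ⇝ C ⅋ B
⅋-⇝ʳ {C = C} ⟪ S , R , T , r , a , b ⟫ =
  ⟪ emb C ⅋ʳ S , R , T , r , ⅋-cong ≈-refl a , ⅋-cong ≈-refl b ⟫

⊗-⇝ˡ : A ⇝ B → A ⊗ C ⇝ B ⊗ C
⊗-⇝ˡ {C = C} ⟪ S , R , T , r , a , b ⟫ =
  ⟪ S ⊗ˡ emb C , R , T , r , ⊗-cong a ≈-refl , ⊗-cong b ≈-refl ⟫

u₁-⇝ : A ⇝ A ⅋ atom bot
u₁-⇝ {A} = ⟪ ∙ , _ , _ , inj₂ (inj₁ (u₁ (emb A))) , ≈-refl , ≈-refl ⟫

u₂-⇝ : A ⇝ A ⊗ atom one
u₂-⇝ {A} = ⟪ ∙ , _ , _ , inj₂ (inj₂ (inj₁ (u₂ (emb A)))) , ≈-refl , ≈-refl ⟫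

ai-⇝ : ∀ n → atom one ⇝ atom (pos n) ⅋ atom (neg n)
ai-⇝ n = ⟪ ∙ , _ , _ , inj₁ (ai (pos n)) , ≈-refl , ≈-refl ⟫

data IsLazy : NNF → Set where
  copar : IsLazy (A ⊗ B)
  atom  : ∀ {a} → a ≢ bot → IsLazy (atom a)

data IsDeep : NNF → Set where
  par  : IsDeep (A ⅋ B)
  atom : ∀ {a} → a ≢ one → IsDeep (atom a)

-- Interaction phrased without negating a structure, which makes it symmetric. Symmetry matters
-- because a switch may have to move either of two interacting structures into the other.
record Clash (A B : NNF) : Set where
  constructor clash
  field
    {a} : Atom
    a∈  : a ∈ atoms A
    ā∈  : dualAtom a ∈ atoms B

clash-sym : Clash A B → Clash B A
clash-sym {A} (clash {a} p q) =
  clash q (subst (_∈ atoms A) (sym (dualAtom-involutive a)) p)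

dual-∈ : ∀ A {a} → a ∈ atoms A → dualAtom a ∈ atoms (dual A)
dual-∈ (atom a) (here refl) = here refl
dual-∈ (A ⅋ B) p with ∈-++⁻ (atoms A) p
... | inj₁ q = ∈-++⁺ˡ (dual-∈ A q)
... | inj₂ q = ∈-++⁺ʳ _ (dual-∈ B q)
dual-∈ (A ⊗ B) p with ∈-++⁻ (atoms A) p
... | inj₁ q = ∈-++⁺ˡ (dual-∈ A q)
... | inj₂ q = ∈-++⁺ʳ _ (dual-∈ B q)

interaction : Clash A B → Interaction (emb A) (emb B)
interaction {A} {B} (clash {a} p q) =
  dualAtom a ,
  subst (λ X → dualAtom a ∈ atoms (dual X)) (sym (nnf-emb A)) (dual-∈ A p) ,
  subst (λ X → dualAtom a ∈ atoms X) (sym (nnf-emb B)) q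

lazy : IsLazy B → Lazy (emb A) (emb B)
lazy copar        = inj₁ (_ , _ , ≈-refl)
lazy (atom a≢bot) = inj₂ (_ , a≢bot , ≈-refl)

deep : IsDeep A → Deep (emb A) (emb B)
deep par          = inj₁ (_ , _ , ≈-refl)
deep (atom a≢one) = inj₂ (_ , a≢one , ≈-refl)

switch-⇝ : ∀ {R T U} → IsDeep R → IsLazy U → Clash R U → (U ⅋ R) ⊗ T ⇝ U ⅋ (R ⊗ T)
switch-⇝ {R} {T} {U} d l c =
  ⟪ ∙ , _ , _ ,
  inj₂ (inj₂ (inj₂ (switch (emb R) (emb T) (emb U)
    (deep {B = U} d , lazy {A = R} l , interaction c)))) ,
  ≈-refl , ≈-refl ⟫

-- Structures as pars of their components.

join : NNF → List NNF → NNF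
join = foldr _⅋_

⅋-swap : A ⅋ (B ⅋ C) ≋ B ⅋ (A ⅋ C)
⅋-swap = ≋-trans (≋-sym ⅋-assoc) (≋-trans (⅋-cong ⅋-comm ≋-refl) ⅋-assoc)

join-⅋ : ∀ M → join (A ⅋ B) M ≋ A ⅋ join B M
join-⅋ []      = ≋-refl
join-⅋ (F ∷ M) = ≋-trans (⅋-cong ≋-refl (join-⅋ M)) ⅋-swap

join-∷ : ∀ M → join A (B ∷ M) ≋ A ⅋ join B M
join-∷ {A} {B} M = ≋-trans (≋-sym (join-⅋ M)) (≋-trans (join-comm M) (join-⅋ M))
  where
  join-comm : ∀ M → join (B ⅋ A) M ≋ join (A ⅋ B) M
  join-comm []      = ⅋-comm
  join-comm (F ∷ M) = ⅋-cong ≋-refl (join-comm M)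

join-cong : M ↭ L → join A M ≋ join A L
join-cong refl         = ≋-refl
join-cong (prep F p)   = ⅋-cong ≋-refl (join-cong p)
join-cong (swap F G p) = ≋-trans ⅋-swap (⅋-cong ≋-refl (⅋-cong ≋-refl (join-cong p)))
join-cong (trans p q)  = ≋-trans (join-cong p) (join-cong q)

join-↭ : A ∷ M ↭ B ∷ L → join A M ≋ join B L
join-↭ {A} {M} {B} {L} p with ∷-↭-∷ p
... | inj₁ (refl , q) = join-cong q
... | inj₂ (K , q , r) =
  ≋-trans (join-cong q) (≋-trans (≋-sym (join-∷ K)) (join-cong (↭-sym r)))

join-++ : ∀ M → join A (M ++ B ∷ L) ≋ join A M ⅋ join B L
join-++ {L = L} [] = join-∷ L
join-++ (F ∷ M) = ≋-trans (⅋-cong ≋-refl (join-++ M)) (≋-sym ⅋-assoc)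

flat-join : ∀ A → ∃[ F ] ∃[ M ] flat A ≡ F ∷ M × A ≋ join F M
flat-join (atom a) = atom a , [] , refl , ≋-refl
flat-join (A ⊗ B)  = A ⊗ B , [] , refl , ≋-refl
flat-join (A ⅋ B) with F , M , p , q ← flat-join A | G , N , r , s ← flat-join B =
  F , M ++ G ∷ N , cong₂ _++_ p r , ≋-trans (⅋-cong q s) (≋-sym (join-++ M))

≋-join : flat A ↭ F ∷ M → A ≋ join F M
≋-join {A} p with G , N , q , r ← flat-join A =
  ≋-trans r (join-↭ (trans (↭-reflexive (sym q)) p))

NonPar : NNF → Set
NonPar A = flat A ≡ [ A ]

flat-nonPar : ∀ A → All NonPar (flat A)
flat-nonPar (atom a) = refl ∷ []
flat-nonPar (A ⅋ B)  = All.++⁺ (flat-nonPar A) (flat-nonPar B)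
flat-nonPar (A ⊗ B)  = refl ∷ []

flat-of-join : All NonPar M → flat (join F M) ≡ M ++ flat F
flat-of-join []       = refl
flat-of-join (p ∷ ps) = cong₂ _++_ p (flat-of-join ps)

-- The first argument of `join` sits innermost, so `M` is merely a par context around it.
join-⇝ : A ⇝ B → ∀ M → join A M ⇝ join B M
join-⇝ s []      = s
join-⇝ s (F ∷ M) = ⅋-⇝ʳ {C = F} (join-⇝ s M)

⇝-weight : A ⇝ B → weight A < weight B
⇝-weight {A} {B} ⟪ i ⟫ =
  subst₂ (λ X Y → weight X < weight Y) (nnf-emb A) (nnf-emb B)
    (_≺_.weight-< (instance-≺ MLSdli i))

-- Switches into a factor of an iterated tensor.

-- The left nesting makes up for the associativity of ⊗: a switch may move U into
-- one factor of an iterated tensor.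
data Absorb (U : NNF) : NNF → NNF → Set where
  here : ∀ {R T} → IsDeep R → Clash R U → Absorb U (R ⊗ T) ((U ⅋ R) ⊗ T)
  left : ∀ {T} → Absorb U F F′ → Absorb U (F ⊗ T) (F′ ⊗ T)

-- Reassociating gathers all factors beside `R` into a single `T`, so that one switch instance
-- suffices.
absorb-switch : Absorb U F F′ →
  ∃[ R ] ∃[ T ] IsDeep R × Clash R U × (U ⅋ R) ⊗ T ≋ F′ × R ⊗ T ≋ F
absorb-switch (here d c) = _ , _ , d , c , ≋-refl , ≋-refl
absorb-switch (left a) with R , T , d , c , p , q ← absorb-switch a =
  R , _ , d , c , ≋-trans (≋-sym ⊗-assoc) (⊗-cong p ≋-refl) ,
  ≋-trans (≋-sym ⊗-assoc) (⊗-cong q ≋-refl)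

absorb-⇝ : IsLazy U → Absorb U F F′ → F′ ⇝ U ⅋ F
absorb-⇝ l a with R , T , d , c , p , q ← absorb-switch a =
  ⇝-resp-≋ p (⅋-cong ≋-refl q) (switch-⇝ d l c)

absorb-clash : Absorb U F F′ → Clash F U
absorb-clash (here _ (clash p q)) = clash (∈-++⁺ˡ p) q
absorb-clash (left a) with clash p q ← absorb-clash a = clash (∈-++⁺ˡ p) q

absorb-lazy : Absorb U F F′ → IsLazy F
absorb-lazy (here _ _) = copar
absorb-lazy (left _)   = copar

absorb-nonPar : Absorb U F F′ → NonPar F′
absorb-nonPar (here _ _) = refl
absorb-nonPar (left _)   = refl

lazy-nonPar : IsLazy U → NonPar U
lazy-nonPar copar    = refl
lazy-nonPar (atom _) = refl

-- U carries its tensor partner B along into F, and B brings its context Δ.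
absorb-⊗ : ⊢ flat B ++ Δ → Absorb U F F′ →
  ∃[ F″ ] Absorb (U ⊗ B) F F″ × (∀ {Γ} → ⊢ F′ ∷ Γ → ⊢ F″ ∷ Δ ++ Γ)
absorb-⊗ {B} {Δ} {U} e (here {R} {T} d (clash p q)) =
  _ , here d (clash p (∈-++⁺ˡ q)) ,
  ⊗-elim (((U ⊗ B) ⅋ R) ⊗ T ∷ Δ) λ {Γ₁} {Γ₂} f g →
    perm (prep _ (++-assoc Δ Γ₁ Γ₂))
      (ten
        (perm (solve 4 (λ x r c b → (x ⊕ (r ⊕ c)) ⊕ b ⊜ (x ⊕ r) ⊕ (b ⊕ c)) refl
                 [ U ⊗ B ] (flat R) Γ₁ Δ)
          (ten {A = U} {Γ = flat R ++ Γ₁}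
            (perm (++-assoc (flat U) (flat R) Γ₁) f) e))
        g)
absorb-⊗ {B} {Δ} {U} e (left {T = T} a)
  with F″ , a′ , f ← absorb-⊗ {B = B} e a = F″ ⊗ T , left a′ ,
  ⊗-elim (F″ ⊗ T ∷ Δ) λ {Γ₁} {Γ₂} g h →
    perm (prep _ (++-assoc Δ Γ₁ Γ₂))
      (ten (subst (λ X → ⊢ X ++ Δ ++ Γ₁) (sym (absorb-nonPar a′))
              (f (subst (λ X → ⊢ X ++ Γ₁) (absorb-nonPar a) g))) h)

-- Steps on sequents and the instances they induce.

-- A step from the conclusion L to a premise that is provable next to K.
data Step (K L : List NNF) : Set where
  local  : L ↭ F ∷ M → F′ ⇝ F → ⊢ K ++ flat F′ ++ M → Step K L
  axiom  : ∀ n → L ↭ atom (pos n) ∷ atom (neg n) ∷ M → ⊢ K ++ atom one ∷ M → Step K L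
  absorb : L ↭ U ∷ F ∷ M → IsLazy U → Absorb U F F′ → ⊢ K ++ F′ ∷ M → Step K L

-- Carries a step below a sequent rule that turns `K` into `N`: the step acts beside `K`, so the
-- rule can be applied again after it.
step-mono : (∀ Θ → ⊢ K ++ Θ → ⊢ N ++ Θ) → M ↭ N ++ L → Step K L → Step [] M
step-mono {N = N} f r (local {F} {M} {F′} p s d) =
  local (trans r (trans (++⁺ˡ N p) (shift F N M))) s
    (perm (shifts N (flat F′)) (f _ d))
step-mono {N = N} f r (axiom {M} n p d) =
  axiom n
    (trans r (trans (++⁺ˡ N p)
      (solve 4 (λ n x y m → n ⊕ (x ⊕ (y ⊕ m)) ⊜ x ⊕ (y ⊕ (n ⊕ m))) refl
        N [ atom (pos n) ] [ atom (neg n) ] M)))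
    (perm (shift _ N M) (f _ d))
step-mono {N = N} f r (absorb {U} {F} {M} p l a d) =
  absorb
    (trans r (trans (++⁺ˡ N p)
      (solve 4 (λ n x y m → n ⊕ (x ⊕ (y ⊕ m)) ⊜ x ⊕ (y ⊕ (n ⊕ m))) refl
        N [ U ] [ F ] M)))
    l a (perm (shift _ N M) (f _ d))

-- `K` is a side context that the instance does not touch, such as the context that the left factor
-- of a tensor shares its premise with.
Reducible : List NNF → NNF → Set
Reducible K A = ∃[ A′ ] A′ ⇝ A × ⊢ flat A′ ++ K

reduce-join : All NonPar M → A ≋ join F M → F′ ⇝ F →
              ⊢ K ++ flat F′ ++ M → Reducible K A
reduce-join {M = M} {F′ = F′} {K = K} ps p s d =
  join F′ M , ⇝-resp-≋ ≋-refl (≋-sym p) (join-⇝ s M) ,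
  subst (λ X → ⊢ X ++ K) (sym (flat-of-join ps))
    (perm (solve 3 (λ k f m → k ⊕ (f ⊕ m) ⊜ (m ⊕ f) ⊕ k) refl K (flat F′) M) d)

≋-join₂ : flat A ↭ U ∷ F ∷ M → A ≋ join (U ⅋ F) M
≋-join₂ {U = U} {F} {M} p =
  ≋-trans (≋-join (trans p (swap U F refl))) (≋-sym (join-⅋ M))

reduce : Step K (flat A) → Reducible K A
reduce {A = A} (local p s d) with _ ∷ ps ← All-resp-↭ p (flat-nonPar A) =
  reduce-join ps (≋-join p) s d
reduce {A = A} (axiom n p d) with _ ∷ _ ∷ ps ← All-resp-↭ p (flat-nonPar A) =
  reduce-join ps (≋-join₂ p) (ai-⇝ n) d
reduce {K} {A} (absorb {M = M} p l a d) with _ ∷ _ ∷ ps ← All-resp-↭ p (flat-nonPar A) =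
  reduce-join ps (≋-join₂ p) (absorb-⇝ l a)
    (subst (λ X → ⊢ K ++ X ++ M) (sym (absorb-nonPar a)) d)

-- The rule `u₁↓` deletes the unit; the second component `F` is what remains in the hole.
reduce-bot : flat A ↭ atom bot ∷ F ∷ M → ⊢ flat A ++ K → Reducible K A
reduce-bot {A} {F} {M} {K} p d with _ ∷ q ∷ ps ← All-resp-↭ p (flat-nonPar A) =
  reduce-join ps (≋-join₂ p) (⇝-resp-≋ ≋-refl ⅋-comm u₁-⇝)
    (subst (λ X → ⊢ K ++ X ++ M) (sym q)
      (perm (++-comm (F ∷ M) K) (bot-elim (perm (++⁺ʳ K p) d))))
  where
  bot-elim : ⊢ atom bot ∷ Γ → ⊢ Γ
  bot-elim = replace {Θ = []} λ where (bot d) → d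

-- Distributing a step over the two parts of a sequent.

data Split (Γ Δ : List NNF) : Set where
  inˡ   : Step Δ Γ → Split Γ Δ
  inʳ   : Step Γ Δ → Split Γ Δ
  cross : ∀ {a} → dualAtom a ≢ bot → Γ ↭ atom a ∷ L → Δ ↭ atom (dualAtom a) ∷ M →
          Split Γ Δ
  intoˡ : Γ ↭ F ∷ L → Δ ↭ U ∷ M → IsLazy U → Absorb U F F′ →
          ⊢ F′ ∷ L ++ M → Split Γ Δ
  intoʳ : Γ ↭ U ∷ L → Δ ↭ F ∷ M → IsLazy U → Absorb U F F′ →
          ⊢ F′ ∷ L ++ M → Split Γ Δ

-- A step touches one component, or two in the cases `axiom` and `absorb`; each of them is located
-- in `Γ` or in `Δ`.
split : ∀ Γ → Step [] (Γ ++ Δ) → Split Γ Δ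
split {Δ} Γ (local {F′ = F′} p s d) with ++-↭-∷ Γ p
... | inj₁ (Γ′ , q , r) =
  inˡ (local q s
    (perm (trans (++⁺ˡ (flat F′) r)
             (solve 3 (λ f a b → f ⊕ (a ⊕ b) ⊜ b ⊕ (f ⊕ a)) refl (flat F′) Γ′ Δ)) d))
... | inj₂ (Δ′ , q , r) =
  inʳ (local q s (perm (trans (++⁺ˡ (flat F′) r) (shifts (flat F′) Γ)) d))
split {Δ} Γ (axiom n p d) with ++-↭-∷ Γ p
... | inj₁ (Γ′ , q , r) with ++-↭-∷ Γ′ (↭-sym r)
...   | inj₁ (Γ″ , s , t) =
  inˡ (axiom n (trans q (prep _ s)) (perm (trans (prep _ t) (++-comm (_ ∷ Γ″) Δ)) d))
...   | inj₂ (Δ′ , s , t) = cross (λ ()) q s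
split {Δ} Γ (axiom n p d) | inj₂ (Δ′ , q , r) with ++-↭-∷ Γ (↭-sym r)
...   | inj₁ (Γ′ , s , t) = cross (λ ()) s q
...   | inj₂ (Δ″ , s , t) =
  inʳ (axiom n (trans q (prep _ s)) (perm (trans (prep _ t) (↭-sym (shift _ Γ Δ″))) d))
split {Δ} Γ (absorb p l a d) with ++-↭-∷ Γ p
... | inj₁ (Γ′ , q , r) with ++-↭-∷ Γ′ (↭-sym r)
...   | inj₁ (Γ″ , s , t) =
  inˡ (absorb (trans q (prep _ s)) l a (perm (trans (prep _ t) (++-comm (_ ∷ Γ″) Δ)) d))
...   | inj₂ (Δ′ , s , t) = intoʳ q s l a (perm (prep _ t) d)
split {Δ} Γ (absorb p l a d) | inj₂ (Δ′ , q , r) with ++-↭-∷ Γ (↭-sym r)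
...   | inj₁ (Γ′ , s , t) = intoˡ s q l a (perm (prep _ t) d)
...   | inj₂ (Δ″ , s , t) =
  inʳ (absorb (trans q (prep _ s)) l a (perm (trans (prep _ t) (↭-sym (shift _ Γ Δ″))) d))

atoms-flat : ∀ A {a} → F ∈ flat A → a ∈ atoms F → a ∈ atoms A
atoms-flat (atom _) (here refl) q = q
atoms-flat (A ⊗ B) (here refl) q = q
atoms-flat (A ⅋ B) p q with ∈-++⁻ (flat A) p
... | inj₁ r = ∈-++⁺ˡ (atoms-flat A r q)
... | inj₂ r = ∈-++⁺ʳ (atoms A) (atoms-flat B r q)

clash-flat : flat A ↭ F ∷ M → Clash F U → Clash A U
clash-flat {A} p (clash q r) =
  clash (atoms-flat A (∈-resp-↭ (↭-sym p) (here refl)) q) r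

-- Each side of the par contributes at least one component.
flat-par : ∀ A B → ¬ (flat (A ⅋ B) ↭ [ F ])
flat-par A B p
  with flat A | flat-join A | flat B | flat-join B | ↭-singleton-inv p
... | _ | _ , []    , refl , _ | _ | _ , _ , refl , _ | ()
... | _ | _ , _ ∷ _ , refl , _ | _ | _ , _ , refl , _ | ()

-- Steps below the tensor rule.

bots : ℕ → List NNF
bots k = replicate k (atom bot)

∈-bots : ∀ k → F ∈ bots k → F ≡ atom bot
∈-bots (suc k) (here refl) = refl
∈-bots (suc k) (there p)   = ∈-bots k p

module _ {A B Γ Δ} (d : ⊢ flat A ++ Γ) (e : ⊢ flat B ++ Δ) where

  private
    AB = A ⊗ B

  ten-reducible : Reducible Γ A → Step [] (A ⊗ B ∷ Γ ++ Δ)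
  ten-reducible (A′ , s , f) = local refl (⊗-⇝ˡ s) (ten f e)

  ten-right : Step (flat A) Γ → Step [] (A ⊗ B ∷ Γ ++ Δ)
  ten-right = step-mono {N = AB ∷ Δ}
    (λ Θ f → perm (prep _ (++-comm Θ Δ)) (ten f e)) (prep _ (++-comm Γ Δ))

  -- After the switch the left factor is `V ⅋ A`, which `d` proves once `V` is counted with `A`
  -- instead of with the context.
  ten-absorb : IsDeep A → IsLazy V → Clash A V → Γ ↭ V ∷ M →
               Step [] (A ⊗ B ∷ Γ ++ Δ)
  ten-absorb {V} {M} deep lazy c p =
    absorb (trans (prep _ (++⁺ʳ Δ p)) (swap _ _ refl)) lazy (here deep c)
      (ten (subst (λ X → ⊢ (X ++ flat A) ++ M) (sym (lazy-nonPar lazy))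
              (perm (trans (++⁺ˡ (flat A) p) (shift V (flat A) M)) d)) e)

  -- Whichever way a step between `A` and `Γ` goes, the member of `Γ` involved is lazy and clashes
  -- with `A`, so it can be moved into `A` as a whole.
  ten-deep : IsDeep A → Split (flat A) Γ → Step [] (A ⊗ B ∷ Γ ++ Δ)
  ten-deep deep (inˡ s) = ten-reducible (reduce s)
  ten-deep deep (inʳ s) = ten-right s
  ten-deep deep (cross a≢ p q) =
    ten-absorb deep (atom a≢) (clash-flat p (clash (here refl) (here refl))) q
  ten-deep deep (intoˡ p q l a f) = ten-absorb deep l (clash-flat p (absorb-clash a)) q
  ten-deep deep (intoʳ p q l a f) =
    ten-absorb deep (absorb-lazy a) (clash-flat p (clash-sym (absorb-clash a))) q

  -- If the 1 lies in `Γ`, then `A` contains a ⊥, and the 1 clashes with it and moves into `A`. If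
  -- the 1 lies in `A`, then `A`, being deep, is a par with a further component ⊥, which `u₁↓`
  -- deletes.
  ten-deep-base : ∀ k → IsDeep A → flat A ++ Γ ↭ atom one ∷ bots k →
                  Step [] (A ⊗ B ∷ Γ ++ Δ)
  ten-deep-base k deep p with ++-↭-∷ (flat A) p
  ten-deep-base k deep p | inj₂ (Γ′ , q , r)
    with F , M , s , t ← flat-join A
    with refl ← ∈-bots k (∈-resp-↭ (↭-sym r) (∈-++⁺ˡ (subst (F ∈_) (sym s) (here refl)))) =
    ten-absorb deep (atom λ ())
      (clash-flat {A} (↭-reflexive s) (clash (here refl) (here refl))) q
  ten-deep-base k (atom a≢one) p | inj₁ (Γ′ , q , r)
    with refl ← ↭-singleton-inv (↭-sym q) = contradiction refl a≢one
  ten-deep-base k par p | inj₁ (F ∷ Γ′ , q , r)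
    with refl ← ∈-bots k (∈-resp-↭ (↭-sym r) (here refl)) =
    ten-reducible (reduce-bot (trans q (swap _ _ refl)) d)
  ten-deep-base k (par {A₁} {A₂}) p | inj₁ ([] , q , r) = contradiction q (flat-par A₁ A₂)

-- A tensor is not a deep R for the switch, so a step that uses A together with Γ
-- is repeated with A ⊗ B in place of A.
ten-copar : ∀ {A₁ A₂} → let A = A₁ ⊗ A₂ in ⊢ A ∷ Γ → ⊢ flat B ++ Δ →
            Split [ A ] Γ → Step [] (A ⊗ B ∷ Γ ++ Δ)
ten-copar {B = B} d e (inˡ s) = ten-reducible {B = B} d e (reduce s)
ten-copar {B = B} d e (inʳ s) = ten-right {B = B} d e s
ten-copar d e (cross _ p _) with () ← ↭-singleton-inv (↭-sym p)
ten-copar {Δ = Δ} {A₁} {A₂} d e (intoˡ p q l a f) with refl ← ↭-singleton-inv (↭-sym p) =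
  absorb (trans (prep _ (++⁺ʳ Δ q)) (swap _ _ refl)) l (left a)
    (ten (subst (λ X → ⊢ X ++ _) (sym (absorb-nonPar a)) f) e)
ten-copar {B = B} {Δ} d e (intoʳ {M = M} p q l a f)
  with refl ← ↭-singleton-inv (↭-sym p)
  with F″ , a′ , g ← absorb-⊗ {B = B} e a =
  absorb (prep _ (++⁺ʳ Δ q)) copar a′ (perm (prep _ (++-comm Δ M)) (g f))

-- Every provable sequent is a base case or admits a step.

Progress : List NNF → Set
Progress L = (∃[ k ] L ↭ atom one ∷ bots k) ⊎ Step [] L

ten-progress : ⊢ flat A ++ Γ → ⊢ flat B ++ Δ → IsDeep A → Progress (flat A ++ Γ) →
               Progress (A ⊗ B ∷ Γ ++ Δ)
ten-progress {B = B} d e deep (inj₁ (k , p)) = inj₂ (ten-deep-base {B = B} d e k deep p)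
ten-progress {A} {B = B} d e deep (inj₂ s) = inj₂ (ten-deep {B = B} d e deep (split (flat A) s))

progress : ⊢ L → Progress L
progress one    = inj₁ (0 , refl)
progress (ax n) = inj₂ (axiom n refl one)
progress (bot d) with progress d
... | inj₁ (k , p) = inj₁ (suc k , trans (prep _ p) (swap _ _ refl))
... | inj₂ s = inj₂ (step-mono {N = [ atom bot ]} (λ _ → bot) refl s)
progress (perm p d) with progress d
... | inj₁ (k , q) = inj₁ (k , trans (↭-sym p) q)
... | inj₂ s = inj₂ (step-mono {N = []} (λ _ → id) (↭-sym p) s)
-- The rule `u₂↓` deletes the left factor 1. The premise is proved by putting `e` at the point of
-- `d` where that 1 is introduced.
progress (ten {atom one} {Γ} {B} {Δ} d e) =
  inj₂ (local refl (⇝-resp-≋ ≋-refl ⊗-comm u₂-⇝)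
    (perm (solve 3 (λ b c a → (b ⊕ c) ⊕ a ⊜ b ⊕ (a ⊕ c)) refl (flat B) Δ Γ)
      (replace {Θ = flat B ++ Δ} (λ where one → perm (↭-sym (++-identityʳ _)) e) d)))
progress (ten {A₁ ⊗ A₂} {Γ} {B} d e) with progress d
... | inj₂ s = inj₂ (ten-copar {B = B} d e (split [ A₁ ⊗ A₂ ] s))
-- The base case is impossible here: the copar `A₁ ⊗ A₂` would have to be 1 or ⊥.
... | inj₁ (k , p) with ∈-resp-↭ p (here refl)
...   | there q with () ← ∈-bots k q
progress (ten {A ⅋ A₁} {B = B} d e)      = ten-progress {A ⅋ A₁} {B = B} d e par (progress d)
progress (ten {atom bot} {B = B} d e)     = ten-progress {B = B} d e (atom λ ()) (progress d)
progress (ten {atom (pos n)} {B = B} d e) = ten-progress {B = B} d e (atom λ ()) (progress d)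
progress (ten {atom (neg n)} {B = B} d e) = ten-progress {B = B} d e (atom λ ()) (progress d)

next : ⊩ A → A ≋ atom one ⊎ ∃[ A′ ] A′ ⇝ A × ⊩ A′
next {A} d with progress d
... | inj₁ (zero  , p) = inj₁ (≋-join p)
-- With at least one ⊥ beside the 1, `u₁↓` deletes it; with none, the structure is 1 and the search
-- is over.
... | inj₁ (suc k , p) = inj₂ (unframe (reduce-bot (trans p (swap _ _ refl))
                                          (perm (↭-sym (++-identityʳ (flat A))) d)))
  where
  unframe : Reducible [] A → ∃[ A′ ] A′ ⇝ A × ⊩ A′
  unframe (A′ , s , f) = A′ , s , perm (++-identityʳ (flat A′)) f
... | inj₂ s with A′ , s , f ← reduce s = inj₂ (A′ , s , perm (++-identityʳ (flat A′)) f)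

-- From sequent proofs to proofs in every system.

append : ∀ {𝒮 P Q R} → Derivation 𝒮 P Q → Instance 𝒮 Q R → Derivation 𝒮 P R
append ([] p) (S , R , T , r , a , b) = (S , R , T , r , ≈-trans p a , b) ∷ [] ≈-refl
append (i ∷ D) j = i ∷ append D j

⊩⇒proof : ∀ A → Acc _<_ (weight A) → ⊩ A → Proof MLSdli (emb A)
⊩⇒proof A (acc rs) d with next {A} d
... | inj₁ p = [] (≈-sym (emb-cong p))
... | inj₂ (A′ , s@(⟪ i ⟫) , f) = append (⊩⇒proof A′ (rs (⇝-weight s)) f) i

dlis⇒switchRule : ∀ 𝒮 {R T} → dlis R T → switchRule 𝒮 R T
dlis⇒switchRule MLSu   (switch R T U _)           = switch R T U
dlis⇒switchRule MLSl   (switch R T U (d , l , i)) = switch R T U l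
dlis⇒switchRule MLSd   (switch R T U (d , l , i)) = switch R T U d
dlis⇒switchRule MLSi   (switch R T U (d , l , i)) = switch R T U i
dlis⇒switchRule MLSdl  (switch R T U (d , l , i)) = switch R T U (d , l)
dlis⇒switchRule MLSli  (switch R T U (d , l , i)) = switch R T U (l , i)
dlis⇒switchRule MLSdi  (switch R T U (d , l , i)) = switch R T U (d , i)
dlis⇒switchRule MLSdli r                          = r

rule-mono : ∀ 𝒮 {R T} → rules MLSdli R T → rules 𝒮 R T
rule-mono 𝒮 (inj₁ r)               = inj₁ r
rule-mono 𝒮 (inj₂ (inj₁ r))        = inj₂ (inj₁ r)
rule-mono 𝒮 (inj₂ (inj₂ (inj₁ r))) = inj₂ (inj₂ (inj₁ r))
rule-mono 𝒮 (inj₂ (inj₂ (inj₂ r))) = inj₂ (inj₂ (inj₂ (dlis⇒switchRule 𝒮 r)))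

derivation-mono : ∀ 𝒮 {P Q} → Derivation MLSdli P Q → Derivation 𝒮 P Q
derivation-mono 𝒮 ([] p) = [] p
derivation-mono 𝒮 ((S , R , T , r , a , b) ∷ D) =
  (S , R , T , rule-mono 𝒮 r , a , b) ∷ derivation-mono 𝒮 D

derivation-resp-≈ : ∀ {𝒮 P Q R} → Derivation 𝒮 P Q → Q ≈ R → Derivation 𝒮 P R
derivation-resp-≈ ([] p) q = [] (≈-trans p q)
derivation-resp-≈ (i ∷ D) q = i ∷ derivation-resp-≈ D q

-- Goes from `𝒮` through the sequent calculus to `MLSdli`, whose instances are instances of every
-- system.
proof-mono : ∀ 𝒮 𝒯 {R} → Proof 𝒮 R → Proof 𝒯 R
proof-mono 𝒮 𝒯 {R} D =
  derivation-mono 𝒯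
    (derivation-resp-≈
      (⊩⇒proof (nnf R) (<-wellFounded _) (derivation-⊩ 𝒮 D one))
      (emb-nnf R))

corollary2p32 : (𝒮 𝒯 : System) → Equivalent 𝒮 𝒯
corollary2p32 𝒮 𝒯 R = mk⇔ (proof-mono 𝒮 𝒯) (proof-mono 𝒯 𝒮)
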